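{- Let $G$ be a (finite simple) chordal graph of minimum degree $k$ and let $p$ be a nonnegative integer with $p<k$. Then $G$ contains a chordal spanning subgraph of minimum degree $p$.
   Context: All graphs are finite and simple. A chord of a cycle $C$ in a graph is an edge of the graph not in $E(C)$ both of whose endpoints lie on $C$. A graph is chordal if every cycle of length greater than three has a chord (equivalently, it contains no induced cycle of length greater than three). Chordal graphs are not required to be connected. A spanning subgraph of $G$ is a subgraph with the same vertex set as $G$. "Minimum degree $p$" means that the minimum degree is exactly $p$. -}

module Defs where

open import Data.Fin.Base using (Fin)
open import Data.Fin.Subset using (Subset; ∣_∣)
open import Data.List.Base using (List; _∷_; _++_; [_]; length)
open import Data.List.Membership.Propositional using (_∈_)
open import Data.List.Relation.Unary.Linked using (Linked)
open import Data.List.Relation.Unary.Unique.Propositional using (Unique)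
open import Data.Nat.Base using (ℕ; _≤_; _<_)
open import Data.Product.Base using (∃-syntax; _×_)
open import Data.Sum.Base using (_⊎_)
open import Data.Vec.Base using (tabulate)
open import Level using (0ℓ)
open import Relation.Binary.Core using (Rel; _⇒_)
open import Relation.Binary.Definitions using (Decidable; Irreflexive; Symmetric)
open import Relation.Binary.PropositionalEquality.Core using (_≡_)
open import Relation.Nullary.Decidable.Core using (does)
open import Relation.Nullary.Negation.Core using (¬_)

-- Finite simple graphs, with vertex set Fin n. Decidability of adjacency is
-- what makes the edge set finite constructively.
record Graph (n : ℕ) : Set₁ where
  field
    Adj    : Rel (Fin n) 0ℓ
    adj?   : Decidable Adj
    sym    : Symmetric Adj
    irrefl : Irreflexive _≡_ Adj

  neighbours : Fin n → Subset n
  neighbours v = tabulate λ w → does (adj? v w)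

  degree : Fin n → ℕ
  degree v = ∣ neighbours v ∣

  -- A cycle is given by the list of its vertices in cyclic order, from an
  -- arbitrary starting vertex; repeating that vertex at the end gives the closing edge.
  record Cycle : Set where
    field
      start : Fin n
      rest  : List (Fin n)

    vertices : List (Fin n)
    vertices = start ∷ rest

    closedWalk : List (Fin n)
    closedWalk = vertices ++ [ start ]

    field
      distinct : Unique vertices
      linked   : Linked Adj closedWalk
      length≥3 : 3 ≤ length vertices

    -- The number of vertices, hence also of edges, of the cycle.
    size : ℕ
    size = length vertices

    Consecutive : Rel (Fin n) 0ℓ
    Consecutive u w = ∃[ xs ] ∃[ ys ] closedWalk ≡ xs ++ u ∷ w ∷ ys

    Edge : Rel (Fin n) 0ℓ
    Edge u w = Consecutive u w ⊎ Consecutive w u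

    Chord : Rel (Fin n) 0ℓ
    Chord u w = Adj u w × ¬ Edge u w × u ∈ vertices × w ∈ vertices

  Chordal : Set
  Chordal = (C : Cycle) → 3 < Cycle.size C → ∃[ u ] ∃[ w ] Cycle.Chord C u w

  -- The minimum degree is exactly k; in particular the graph is nonempty.
  MinDegree : ℕ → Set
  MinDegree k = (∀ v → k ≤ degree v) × ∃[ v ] degree v ≡ k

-- H and G have the same vertex set by typing.
SpanningSubgraph : ∀ {n} → Graph n → Graph n → Set
SpanningSubgraph H G = Graph.Adj H ⇒ Graph.Adj G

{-# OPTIONS --safe #-}
-- In a chordal graph some vertex v is simplicial (Dirac): its neighbours are
-- pairwise adjacent. Deleting all but p of the edges at v leaves v of degree p,
-- lowers every other degree by at most one, hence not below p, and keeps the graph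
-- chordal: a long cycle avoiding v keeps its chord, and one through v has the chord
-- joining the two neighbours of v on it.
--
-- A simplicial vertex of the subgraph induced by A is found by recursion on A. If A
-- is not a clique, take a connected set U for which the set B of vertices of A
-- neither in U nor adjacent to U is nonempty, and enlarge U as long as B can be made
-- smaller. In the end, every vertex s adjacent both to U and to B is adjacent to all
-- of B. Two such vertices s, t are adjacent, for otherwise an induced path from s to t
-- through U closes up with any b in B to a chordless cycle. So a simplicial vertex
-- of B is simplicial in A.
module Submission where

open import Data.Fin.Base using (Fin; zero; suc)
open import Data.Fin.Properties using (_≟_)
open import Data.Fin.Subset using (Subset; inside; outside; ∣_∣; _⊆_)
  renaming (_∈_ to _∈ₛ_; ⊥ to ∅)
open import Data.Fin.Subset.Properties
  using (_∈?_; drop-there; s⊆s; ⊥⊆; ∣⊥∣≡0; p⊆q⇒∣p∣≤∣q∣)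
open import Data.List.Base using (List; []; _∷_; _++_; [_]; length; filter; allFin; initLast; _∷ʳ′_)
open import Data.List.Membership.Propositional using (_∈_; find; lose)
open import Data.List.Membership.Propositional.Properties
  using (∈-filter⁺; ∈-filter⁻; ∈-++⁺ʳ; ∈-++⁻; ∈-∃++; ∈-allFin)
open import Data.List.Properties
  using (++-assoc; filter-notAll; ∷-injectiveˡ;
  ∷-injectiveʳ; length-++-comm)
open import Data.List.Relation.Unary.All as All using (All; []; _∷_)
open import Data.List.Relation.Unary.All.Properties using (¬Any⇒All¬)
open import Data.List.Relation.Unary.Any using (Any; here; there; any?)
open import Data.List.Relation.Unary.AllPairs using ([]; _∷_)
open import Data.List.Relation.Unary.Linked as Linked using (Linked; [-]; _∷_)
open import Data.List.Relation.Unary.Unique.Propositional using (Unique)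
open import Data.List.Relation.Unary.Unique.Propositional.Properties
  using () renaming (++⁺ to Unique-++⁺)
open import Data.Nat.Base using (ℕ; zero; suc; _≤_; _<_; z≤n; s≤s; s≤s⁻¹)
open import Data.Nat.Induction using (<-wellFounded)
open import Data.Nat.Properties using (≤-trans; ≤-reflexive; ≤-antisym; <⇒≤; m≤n⇒m≤1+n; <-trans)
open import Data.Product.Base using (∃-syntax; _×_; _,_; proj₁; proj₂)
open import Data.Sum.Base as Sum using (_⊎_; inj₁; inj₂)
open import Data.Vec.Base using ([]; _∷_; here; there)
open import Data.Vec.Properties using ([]=⇒lookup; lookup⇒[]=; lookup∘tabulate)
open import Function.Base using (_∘_)
open import Induction.WellFounded using (Acc; acc)
open import Relation.Binary.Construct.Closure.ReflexiveTransitive as Star using (Star; ε; _◅_; _◅◅_)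
open import Relation.Binary.PropositionalEquality
  using (_≡_; _≢_; refl; cong; subst; trans) renaming (sym to ≡-sym)
open import Relation.Nullary using (¬_; Dec; yes; no; contradiction)
open import Relation.Nullary.Decidable using (_⊎-dec_; _×-dec_; _→-dec_; ¬?; decidable-stable; dec-true)
open import Defs

-- Lists read as closed walks.

module _ {a} {A : Set a} where

  Linked-consecutive : ∀ {ℓ} {R : A → A → Set ℓ} xs {u w ys} → Linked R (xs ++ u ∷ w ∷ ys) → R u w
  Linked-consecutive []       rs = Linked.head rs
  Linked-consecutive (_ ∷ xs) rs = Linked-consecutive xs (Linked.tail rs)

  Linked-∷ʳ : ∀ {ℓ} {R : A → A → Set ℓ} xs {u w} → Linked R (xs ++ [ u ]) → R u w →
              Linked R ((xs ++ [ u ]) ++ [ w ])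
  Linked-∷ʳ []           rs       r = r ∷ [-]
  Linked-∷ʳ (_ ∷ [])     (q ∷ rs) r = q ∷ r ∷ [-]
  Linked-∷ʳ (_ ∷ x ∷ xs) (q ∷ rs) r = q ∷ Linked-∷ʳ (x ∷ xs) rs r

  predecessor-∈ : ∀ vs {z : A} xs {u w ys} → vs ++ [ z ] ≡ xs ++ u ∷ w ∷ ys → u ∈ vs
  predecessor-∈ []       []           ()
  predecessor-∈ []       (_ ∷ [])     ()
  predecessor-∈ []       (_ ∷ _ ∷ _)  ()
  predecessor-∈ (_ ∷ vs) []       eq = here (≡-sym (∷-injectiveˡ eq))
  predecessor-∈ (_ ∷ vs) (_ ∷ xs) eq = there (predecessor-∈ vs xs (∷-injectiveʳ eq))

  -- The closing entry `z` is the only one that can repeat a vertex, and nothing follows it, so each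
  -- vertex has at most one occurrence with a successor. This is how two vertices of a cycle are
  -- shown not to be consecutive.
  successor-unique : ∀ {vs} {z : A} xs xs′ {u w w′ ys ys′} → Unique vs →
                     vs ++ [ z ] ≡ xs ++ u ∷ w ∷ ys → vs ++ [ z ] ≡ xs′ ++ u ∷ w′ ∷ ys′ → w ≡ w′
  successor-unique {[]} xs xs′ _ eq eq′ with () ← predecessor-∈ [] xs eq
  successor-unique {_ ∷ vs} [] [] _ eq eq′ =
    ∷-injectiveˡ (trans (≡-sym (∷-injectiveʳ eq)) (∷-injectiveʳ eq′))
  successor-unique {_ ∷ vs} [] (_ ∷ xs′) (v∉ ∷ _) eq eq′ =
    contradiction (∷-injectiveˡ eq) (All.lookup v∉ (predecessor-∈ vs xs′ (∷-injectiveʳ eq′)))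
  successor-unique {_ ∷ vs} (_ ∷ xs) [] (v∉ ∷ _) eq eq′ =
    contradiction (∷-injectiveˡ eq′) (All.lookup v∉ (predecessor-∈ vs xs (∷-injectiveʳ eq)))
  successor-unique {_ ∷ vs} (_ ∷ xs) (_ ∷ xs′) (_ ∷ uniq) eq eq′ =
    successor-unique xs xs′ uniq (∷-injectiveʳ eq) (∷-injectiveʳ eq′)

-- Cardinalities of finite subsets.

subset-of-size : ∀ {n} m (q : Subset n) → m ≤ ∣ q ∣ → ∃[ s ] s ⊆ q × ∣ s ∣ ≡ m
subset-of-size {n} zero q            _   = ∅ , ⊥⊆ , ∣⊥∣≡0 n
subset-of-size (suc m) (outside ∷ q) m<q with subset-of-size (suc m) q m<q
... | s , s⊆q , eq = outside ∷ s , s⊆s s⊆q , eq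
subset-of-size (suc m) (inside ∷ q)  m<q with subset-of-size m q (s≤s⁻¹ m<q)
... | s , s⊆q , eq = inside ∷ s , s⊆s s⊆q , cong suc eq

p-x⊆q⇒∣p∣≤1+∣q∣ : ∀ {n} (x : Fin n) {p q : Subset n} →
                   (∀ {y} → y ≢ x → y ∈ₛ p → y ∈ₛ q) → ∣ p ∣ ≤ suc ∣ q ∣
p-x⊆q⇒∣p∣≤1+∣q∣ zero {outside ∷ p} {outside ∷ q} sub =
  m≤n⇒m≤1+n (p⊆q⇒∣p∣≤∣q∣ (drop-there ∘ sub (λ ()) ∘ there))
p-x⊆q⇒∣p∣≤1+∣q∣ zero {outside ∷ p} {inside ∷ q} sub =
  m≤n⇒m≤1+n (m≤n⇒m≤1+n (p⊆q⇒∣p∣≤∣q∣ (drop-there ∘ sub (λ ()) ∘ there)))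
p-x⊆q⇒∣p∣≤1+∣q∣ zero {inside ∷ p} {outside ∷ q} sub =
  s≤s (p⊆q⇒∣p∣≤∣q∣ (drop-there ∘ sub (λ ()) ∘ there))
p-x⊆q⇒∣p∣≤1+∣q∣ zero {inside ∷ p} {inside ∷ q} sub =
  m≤n⇒m≤1+n (s≤s (p⊆q⇒∣p∣≤∣q∣ (drop-there ∘ sub (λ ()) ∘ there)))
p-x⊆q⇒∣p∣≤1+∣q∣ (suc x) {outside ∷ p} {outside ∷ q} sub =
  p-x⊆q⇒∣p∣≤1+∣q∣ x (λ y≢x → drop-there ∘ sub (λ { refl → y≢x refl }) ∘ there)
p-x⊆q⇒∣p∣≤1+∣q∣ (suc x) {outside ∷ p} {inside ∷ q} sub =
  m≤n⇒m≤1+n (p-x⊆q⇒∣p∣≤1+∣q∣ x (λ y≢x → drop-there ∘ sub (λ { refl → y≢x refl }) ∘ there))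
p-x⊆q⇒∣p∣≤1+∣q∣ (suc x) {inside ∷ p} {outside ∷ q} sub with () ← sub (λ ()) here
p-x⊆q⇒∣p∣≤1+∣q∣ (suc x) {inside ∷ p} {inside ∷ q} sub =
  s≤s (p-x⊆q⇒∣p∣≤1+∣q∣ x (λ y≢x → drop-there ∘ sub (λ { refl → y≢x refl }) ∘ there))

-- Induced paths and connected vertex sets.

module _ {n} (G : Graph n) where
  open Graph G

  ∈-neighbours⁺ : ∀ {v w} → Adj v w → w ∈ₛ neighbours v
  ∈-neighbours⁺ {v} {w} vw =
    lookup⇒[]= w _ (trans (lookup∘tabulate _ w) (dec-true (adj? v w) vw))

  ∈-neighbours⁻ : ∀ {v w} → w ∈ₛ neighbours v → Adj v w
  ∈-neighbours⁻ {v} {w} w∈ with adj? v w | trans (≡-sym (lookup∘tabulate _ w)) ([]=⇒lookup w∈)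
  ... | yes vw | _  = vw
  ... | no  _  | ()

  -- The second argument is the list of the vertices after the starting vertex.
  data InducedPath : Fin n → List (Fin n) → Fin n → Set where
    []  : ∀ {s} → InducedPath s [] s
    _∷_ : ∀ {s u l t} → Adj s u × All (s ≢_) (u ∷ l) × All (λ x → ¬ Adj s x) l →
          InducedPath u l t → InducedPath s (u ∷ l) t

  Near : Fin n → Fin n → Set
  Near x y = x ≡ y ⊎ Adj x y

  near? : ∀ x y → Dec (Near x y)
  near? x y = x ≟ y ⊎-dec adj? x y

  -- The new path enters the given one at its last vertex near s.
  induced-∷ : ∀ {Q : Fin n → Set} {s u l t} → InducedPath u l t → Q s → All Q (u ∷ l) →
              Any (Near s) (u ∷ l) → ∃[ l′ ] InducedPath s l′ t × All Q (s ∷ l′)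
  induced-∷ [] qs (qu ∷ []) (here (inj₁ refl)) = [] , [] , qs ∷ []
  induced-∷ [] qs (qu ∷ []) (here (inj₂ su)) =
    _ , (su , (λ s≡u → irrefl s≡u su) ∷ [] , []) ∷ [] , qs ∷ qu ∷ []
  induced-∷ {s = s} {l = l} (e ∷ π) qs (qu ∷ ql) near with any? (near? s) l
  ... | yes near′ = induced-∷ π qs ql near′
  induced-∷ (e ∷ π) qs (qu ∷ ql) (there near)            | no far = contradiction near far
  induced-∷ (e ∷ π) qs (qu ∷ ql) (here (inj₁ refl))      | no far = _ , e ∷ π , qu ∷ ql
  induced-∷ (e ∷ π) qs (qu ∷ ql) (here (inj₂ su))        | no far =
    _ , (su , (λ s≡u → irrefl s≡u su) ∷ All.map (_∘ inj₁) far′ , All.map (_∘ inj₂) far′) ∷ e ∷ π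
      , qs ∷ qu ∷ ql
    where far′ = ¬Any⇒All¬ _ far

  -- Only the target of a step carries `Q`, so walks concatenate directly; for the start of a walk,
  -- `Q` is supplied separately.
  StepIn : (Fin n → Set) → Fin n → Fin n → Set
  StepIn Q x y = Adj x y × Q y

  -- The tail of the walk is shortened first; `s` is then adjacent to the first vertex of the
  -- resulting path, hence near it, as `induced-∷` requires.
  induced-path : ∀ {Q : Fin n → Set} {s t} → Star (StepIn Q) s t → Q s →
                 ∃[ l ] InducedPath s l t × All Q (s ∷ l)
  induced-path ε qs = [] , [] , qs ∷ []
  induced-path ((su , qu) ◅ walk) qs with induced-path walk qu
  ... | _ , π , ql = induced-∷ π qs ql (here (inj₂ su))

  induced-unique : ∀ {s l t} → InducedPath s l t → Unique (s ∷ l)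
  induced-unique []                = [] ∷ []
  induced-unique ((_ , s∉ , _) ∷ π) = s∉ ∷ induced-unique π

  induced-linked : ∀ {s l t b} → InducedPath s l t → Adj t b → Linked Adj (s ∷ l ++ [ b ])
  induced-linked []             tb = tb ∷ [-]
  induced-linked ((su , _) ∷ π) tb = su ∷ induced-linked π tb

  induced-last : ∀ {s l t} → InducedPath s l t → ∃[ xs ] s ∷ l ≡ xs ++ [ t ]
  induced-last []          = [] , refl
  induced-last {s} (_ ∷ π) with induced-last π
  ... | xs , eq = s ∷ xs , cong (s ∷_) eq

  Consecutive : List (Fin n) → Fin n → Fin n → Set
  Consecutive l u w = ∃[ xs ] ∃[ ys ] l ≡ xs ++ u ∷ w ∷ ys

  consecutive-∷ : ∀ {l u w} x → Consecutive l u w → Consecutive (x ∷ l) u w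
  consecutive-∷ x (xs , ys , refl) = x ∷ xs , ys , refl

  consecutive-++ : ∀ {l u w} z → Consecutive l u w → Consecutive (l ++ z) u w
  consecutive-++ z (xs , ys , refl) = xs , ys ++ z , ++-assoc xs _ z

  induced-consecutive : ∀ {s l t u w} → InducedPath s l t → u ∈ s ∷ l → w ∈ s ∷ l → Adj u w →
                        Consecutive (s ∷ l) u w ⊎ Consecutive (s ∷ l) w u
  induced-consecutive π (here refl) (here refl) uw = contradiction uw (irrefl refl)
  induced-consecutive (_ ∷ π) (here refl) (there (here refl)) uw = inj₁ ([] , _ , refl)
  induced-consecutive ((_ , _ , far) ∷ π) (here refl) (there (there w∈)) uw =
    contradiction uw (All.lookup far w∈)
  induced-consecutive (_ ∷ π) (there (here refl)) (here refl) uw = inj₂ ([] , _ , refl)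
  induced-consecutive ((_ , _ , far) ∷ π) (there (there u∈)) (here refl) uw =
    contradiction (sym uw) (All.lookup far u∈)
  induced-consecutive (_ ∷ π) (there u∈) (there w∈) uw =
    Sum.map (consecutive-∷ _) (consecutive-∷ _) (induced-consecutive π u∈ w∈ uw)

  -- Connectedness is recorded by an order of construction: the head is the latest vertex, attached
  -- to one already present. This is how `enlarge` grows its set.
  data Connected : List (Fin n) → Set where
    root : ∀ u → Connected [ u ]
    _∷_  : ∀ {s u U} → u ∈ U × Adj u s → Connected U → Connected (s ∷ U)

  connected-walk : ∀ {U u w} → Connected U → u ∈ U → w ∈ U → Star (StepIn (_∈ U)) u w
  connected-walk _ (here refl) (here refl) = ε
  connected-walk ((v∈ , vs) ∷ conn) (here refl) (there w∈) =
    (sym vs , there v∈) ◅ Star.map (λ (xy , y∈) → xy , there y∈) (connected-walk conn v∈ w∈)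
  connected-walk ((v∈ , vs) ∷ conn) (there u∈) (here refl) =
    Star.map (λ (xy , y∈) → xy , there y∈) (connected-walk conn u∈ v∈) ◅◅ (vs , here refl) ◅ ε
  connected-walk (_ ∷ conn) (there u∈) (there w∈) =
    Star.map (λ (xy , y∈) → xy , there y∈) (connected-walk conn u∈ w∈)

  NearAny : List (Fin n) → Fin n → Set
  NearAny U x = Any (λ u → Near u x) U

  -- If `s` belonged to `U`, its neighbour `b` would be near `U`.
  nearAny-adj : ∀ {U s b} → NearAny U s → Adj s b → ¬ NearAny U b → ∃[ u ] u ∈ U × Adj u s
  nearAny-adj near sb far with find near
  ... | u , u∈ , inj₁ refl = contradiction (lose u∈ (inj₂ sb)) far
  ... | u , u∈ , inj₂ us   = u , u∈ , us

  -- Clique separators in chordal graphs.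

  module _ (chordal : Chordal) where

    -- A path with at least two edges would close up through `b` to a cycle of length at least four.
    -- Every adjacency among its vertices is an edge of the cycle, so it would have no chord.
    ends-adjacent : ∀ {s l t b} → InducedPath s l t → s ≢ t → Adj b s → Adj b t →
                    (∀ {x} → x ∈ s ∷ l → b ≢ x × (Adj b x → x ≡ s ⊎ x ≡ t)) → Adj s t
    ends-adjacent [] s≢t _ _ _ = contradiction refl s≢t
    ends-adjacent ((st , _) ∷ []) _ _ _ _ = st
    ends-adjacent {s} {l@(_ ∷ _ ∷ _)} {t} {b} π@(_ ∷ _ ∷ _) s≢t bs bt apart
      with chordal cycle (s≤s (s≤s (s≤s (s≤s z≤n))))
      where
      cycle : Cycle
      cycle = record
        { start = b ; rest = s ∷ l
        ; distinct = All.tabulate (proj₁ ∘ apart) ∷ induced-unique π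
        ; linked = bs ∷ induced-linked π (sym bt)
        ; length≥3 = s≤s (s≤s (s≤s z≤n)) }
    ... | u , w , uw , ¬edge , u∈ , w∈ = contradiction (edge u∈ w∈ uw) ¬edge
      where
      closed = b ∷ (s ∷ l) ++ [ b ]

      first : Consecutive closed b s
      first = [] , _ , refl

      last : Consecutive closed t b
      last with induced-last π
      ... | xs , eq = b ∷ xs , [] ,
        cong (b ∷_) (trans (cong (_++ [ b ]) eq) (++-assoc xs _ _))

      edge : ∀ {u w} → u ∈ b ∷ s ∷ l → w ∈ b ∷ s ∷ l → Adj u w →
             Consecutive closed u w ⊎ Consecutive closed w u
      edge (here refl) (here refl) uw = contradiction uw (irrefl refl)
      edge (here refl) (there w∈) uw with proj₂ (apart w∈) uw
      ... | inj₁ refl = inj₁ first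
      ... | inj₂ refl = inj₂ last
      edge (there u∈) (here refl) uw with proj₂ (apart u∈) (sym uw)
      ... | inj₁ refl = inj₂ first
      ... | inj₂ refl = inj₁ last
      edge (there u∈) (there w∈) uw =
        Sum.map (consecutive-∷ b ∘ consecutive-++ _) (consecutive-∷ b ∘ consecutive-++ _)
                (induced-consecutive π u∈ w∈ uw)

    -- A walk from `s` to `t` through `U` shortens to an induced path within `s`, `t` and `U`. Since
    -- `b` is not near `U`, its only neighbours on that path are the two ends.
    separator-clique : ∀ {U s t b} → Connected U → NearAny U s → NearAny U t → ¬ NearAny U b →
                       Adj b s → Adj b t → s ≢ t → Adj s t
    separator-clique {U} {s} {t} {b} conn near-s near-t far bs bt s≢t
      with nearAny-adj near-s (sym bs) far | nearAny-adj near-t (sym bt) far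
    ... | u , u∈ , us | w , w∈ , wt
      with induced-path {Q = _∈ s ∷ t ∷ U}
             ((sym us , there (there u∈)) ◅
              Star.map (λ (xy , y∈) → xy , there (there y∈)) (connected-walk conn u∈ w∈) ◅◅
              (wt , there (here refl)) ◅ ε)
             (here refl)
    ... | l , π , l⊆ = ends-adjacent π s≢t bs bt (apart ∘ All.lookup l⊆)
      where
      apart : ∀ {x} → x ∈ s ∷ t ∷ U → b ≢ x × (Adj b x → x ≡ s ⊎ x ≡ t)
      apart (here refl)         = (λ b≡s → irrefl b≡s bs) , (λ _ → inj₁ refl)
      apart (there (here refl)) = (λ b≡t → irrefl b≡t bt) , (λ _ → inj₂ refl)
      apart (there (there x∈))  =
        (λ { refl → far (lose x∈ (inj₁ refl)) }) , (λ bx → contradiction (lose x∈ (inj₂ (sym bx))) far)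

    -- Existence of a simplicial vertex in an induced subgraph.

    Simplicial : List (Fin n) → Fin n → Set
    Simplicial A x = ∀ {y z} → y ∈ A → z ∈ A → Adj x y → Adj x z → y ≢ z → Adj y z

    HasSimplicial : List (Fin n) → Set
    HasSimplicial A = ∃[ x ] x ∈ A × Simplicial A x

    -- `smaller` is the induction hypothesis of `simplicial`; the member `b` witnesses that `B` is
    -- nonempty.
    module _ (A : List (Fin n))
             (smaller : ∀ {B b} → length B < length A → b ∈ B → HasSimplicial B) where

      -- The last two hypotheses make `B` the set of vertices of `A` not near `U`. Adding `s` to `U`
      -- drops its neighbour `c` from `B` and keeps its non-neighbour `d`, so `B` shrinks but stays
      -- nonempty.
      enlarge : ∀ {U B b} → Connected U → Acc _<_ (length B) → length B < length A → b ∈ B →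
                (∀ {x} → x ∈ B → x ∈ A × ¬ NearAny U x) →
                (∀ {x} → x ∈ A → x ∈ B ⊎ NearAny U x) → HasSimplicial A
      enlarge {U} {B} {b} conn (acc rs) B<A b∈ B⁻ B⁺
        with any? (λ s → any? (λ u → near? u s) U ×-dec any? (adj? s) B ×-dec any? (¬? ∘ adj? s) B) A
      ... | yes some with find some
      ...   | s , s∈ , near , B-adj , B-nonadj with find B-adj | find B-nonadj
      ...     | c , c∈ , sc | d , d∈ , ¬sd =
        enlarge (proj₂ (nearAny-adj near sc (proj₂ (B⁻ c∈))) ∷ conn) (rs B′<B) (<-trans B′<B B<A)
                (∈-filter⁺ far? d∈ d-far) B′⁻ B′⁺
        where
        far? : ∀ x → Dec (¬ Near s x)
        far? x = ¬? (near? s x)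

        d-far : ¬ Near s d
        d-far (inj₁ refl) = proj₂ (B⁻ d∈) near
        d-far (inj₂ sd)   = ¬sd sd

        B′<B = filter-notAll far? B (lose c∈ (λ far → far (inj₂ sc)))

        B′⁻ : ∀ {x} → x ∈ filter far? B → x ∈ A × ¬ NearAny (s ∷ U) x
        B′⁻ x∈ with ∈-filter⁻ far? x∈
        ... | x∈B , far = proj₁ (B⁻ x∈B) ,
          λ { (here near) → far near ; (there near) → proj₂ (B⁻ x∈B) near }

        B′⁺ : ∀ {x} → x ∈ A → x ∈ filter far? B ⊎ NearAny (s ∷ U) x
        B′⁺ {x} x∈ with B⁺ x∈ | near? s x
        ... | inj₂ near | _        = inj₂ (there near)
        ... | inj₁ _    | yes near = inj₂ (here near)
        ... | inj₁ x∈B  | no far   = inj₁ (∈-filter⁺ far? x∈B far)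
      enlarge {U} {B} {b} conn _ B<A b∈ B⁻ B⁺ | no none with smaller B<A b∈
      ... | x , x∈ , simp = x , proj₁ (B⁻ x∈) , simp′
        where
        complete : ∀ {s c} → s ∈ A → NearAny U s → Adj s x → c ∈ B → Adj s c
        complete {s} {c} s∈ near sx c∈ = decidable-stable (adj? s c)
          (λ ¬sc → none (lose s∈ (near , lose x∈ sx , lose c∈ ¬sc)))

        -- Neighbours of `x` in `A` lie in `B` or near `U`. A pair inside `B` is settled by the
        -- choice of `x`, a mixed pair by `complete`, and a pair near `U` by the separator argument
        -- with `x` as the outside vertex.
        simp′ : Simplicial A x
        simp′ y∈ z∈ xy xz y≢z with B⁺ y∈ | B⁺ z∈
        ... | inj₁ y∈B  | inj₁ z∈B  = simp y∈B z∈B xy xz y≢z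
        ... | inj₁ y∈B  | inj₂ near = sym (complete z∈ near (sym xz) y∈B)
        ... | inj₂ near | inj₁ z∈B  = complete y∈ near (sym xy) z∈B
        ... | inj₂ ny   | inj₂ nz   = separator-clique conn ny nz (proj₂ (B⁻ x∈)) xy xz y≢z

    simplicial : ∀ {A a} → Acc _<_ (length A) → a ∈ A → HasSimplicial A
    simplicial {A} {a} (acc rs) a∈ with any? (λ u → any? (λ w → ¬? (near? u w)) A) A
    ... | no clique = a , a∈ , λ {y} {z} y∈ z∈ _ _ y≢z → decidable-stable (adj? y z)
          (λ ¬yz → clique (lose y∈ (lose z∈ Sum.[ y≢z , ¬yz ])))
    ... | yes some with find some
    ...   | u , u∈ , some′ with find some′
    ...     | w , w∈ , ¬uw =
      -- The growing set starts as `u` alone. Its complement in `A` contains `w` and misses `u`.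
      enlarge A (λ B<A → simplicial (rs B<A)) (root u) (<-wellFounded _)
              (filter-notAll far? A (lose u∈ (λ far → far (inj₁ refl))))
              (∈-filter⁺ far? w∈ ¬uw)
              (λ x∈ → proj₁ (∈-filter⁻ far? x∈) ,
                      λ { (here near) → proj₂ (∈-filter⁻ far? {xs = A} x∈) near })
              B⁺
      where
      far? : ∀ x → Dec (¬ Near u x)
      far? x = ¬? (near? u x)

      B⁺ : ∀ {x} → x ∈ A → x ∈ filter far? A ⊎ NearAny [ u ] x
      B⁺ {x} x∈ with near? u x
      ... | yes near = inj₂ (here near)
      ... | no far   = inj₁ (∈-filter⁺ far? x∈ far)

    simplicial-vertex : Fin n → ∃[ v ] (∀ {y z} → Adj v y → Adj v z → y ≢ z → Adj y z)
    simplicial-vertex v₀ with simplicial (<-wellFounded _) (∈-allFin v₀)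
    ... | v , _ , simp = v , simp (∈-allFin _) (∈-allFin _)

-- Chords of cycles through a simplicial vertex.

module _ {n} (G : Graph n) where
  open Graph G

  HasChord : Cycle → Set
  HasChord C = ∃[ u ] ∃[ w ] Cycle.Chord C u w

  -- The chord joins the second vertex `a` and the last vertex `b`. They are not consecutive: `a` is
  -- followed by `c`, which differs from `b`, and `b` by the start, which differs from `a`.
  chord-through-start : ∀ (C : Cycle) → 3 < Cycle.size C →
    (∀ {a b} → Adj (Cycle.start C) a → Adj (Cycle.start C) b → a ≢ b → Adj a b) → HasChord C
  chord-through-start record { rest = []        ; length≥3 = s≤s () }
  chord-through-start record { rest = _ ∷ []    ; length≥3 = s≤s (s≤s ()) }
  chord-through-start record { rest = a ∷ c ∷ r } 3<size simp with initLast r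
  chord-through-start _ (s≤s (s≤s (s≤s ()))) simp | []
  chord-through-start
    C@record { start = v ; rest = a ∷ c ∷ _ ; distinct = uniq@(v∉ ∷ a∉ ∷ c∉ ∷ _) ; linked = va ∷ _ }
    _ simp | xs ∷ʳ′ b =
    a , b , simp va (sym bv) (All.lookup a∉ (there b∈)) , ¬edge ,
    there (here refl) , there (there (there b∈))
    where
    b∈ : b ∈ xs ++ [ b ]
    b∈ = ∈-++⁺ʳ xs (here refl)

    closing : Cycle.closedWalk C ≡ (v ∷ a ∷ c ∷ xs) ++ b ∷ v ∷ []
    closing = cong (λ l → v ∷ a ∷ c ∷ l) (++-assoc xs _ _)

    bv : Adj b v
    bv = Linked-consecutive (v ∷ a ∷ c ∷ xs) (subst (Linked Adj) closing (Cycle.linked C))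

    ¬edge : ¬ Cycle.Edge C a b
    ¬edge (inj₁ (ps , _ , eq)) =
      All.lookup c∉ b∈ (successor-unique (v ∷ []) ps uniq refl eq)
    ¬edge (inj₂ (ps , _ , eq)) =
      All.lookup v∉ (here refl) (successor-unique (v ∷ a ∷ c ∷ xs) ps uniq closing eq)

  -- The cycle is rotated one vertex at a time until `v` is the start; `xs` lists the vertices still
  -- before it.
  chord-through : ∀ {v} → (∀ {a b} → Adj v a → Adj v b → a ≢ b → Adj a b) →
                  ∀ (C : Cycle) xs {ys} → Cycle.vertices C ≡ xs ++ v ∷ ys →
                  3 < Cycle.size C → HasChord C
  chord-through simp C [] refl 3<size = chord-through-start C 3<size simp
  chord-through simp record { rest = [] ; length≥3 = s≤s () } (_ ∷ xs)
  chord-through simp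
    C@record { start = x ; rest = y ∷ zs ; distinct = x∉ ∷ uniq ; linked = xy ∷ linked }
    (_ ∷ xs) eq 3<size
    with chord-through simp rotated xs
           (trans (cong (_++ [ x ]) (∷-injectiveʳ eq)) (++-assoc xs _ _))
           (subst (3 <_) same-size 3<size)
    where
    same-size : length (x ∷ y ∷ zs) ≡ length (y ∷ zs ++ [ x ])
    same-size = length-++-comm [ x ] (y ∷ zs)

    rotated : Cycle
    rotated = record
      { start = y ; rest = zs ++ [ x ]
      ; distinct = Unique-++⁺ uniq ([] ∷ []) (λ { (v∈ , here refl) → All.lookup x∉ v∈ refl })
      ; linked = Linked-∷ʳ (y ∷ zs) linked xy
      ; length≥3 = subst (3 ≤_) same-size (Cycle.length≥3 C) }
  ... | u , w , uw , ¬edge , u∈ , w∈ =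
    u , w , uw , ¬edge ∘ Sum.map rotate rotate , unrotate u∈ , unrotate w∈
    where
    -- The opening pair `x`, `y` becomes the closing one and the other pairs keep their order. Hence
    -- a non-edge of the rotated cycle is a non-edge of the original.
    rotate : ∀ {u w} → Consecutive G (x ∷ y ∷ zs ++ [ x ]) u w →
             Consecutive G ((y ∷ zs ++ [ x ]) ++ [ y ]) u w
    rotate ([] , _ , refl) = y ∷ zs , [] , ++-assoc (y ∷ zs) _ _
    rotate (_ ∷ ps , qs , eq) = consecutive-++ G [ y ] (ps , qs , ∷-injectiveʳ eq)

    unrotate : ∀ {u} → u ∈ y ∷ zs ++ [ x ] → u ∈ x ∷ y ∷ zs
    unrotate u∈ with ∈-++⁻ (y ∷ zs) u∈
    ... | inj₁ u∈′        = there u∈′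
    ... | inj₂ (here refl) = here refl

-- Deleting the edges from a vertex to all but chosen neighbours.

module _ {n} (G : Graph n) (v : Fin n) (S : Subset n) where
  open Graph G

  restrictAt : Graph n
  restrictAt = record
    { Adj    = λ x y → Adj x y × (x ≡ v → y ∈ₛ S) × (y ≡ v → x ∈ₛ S)
    ; adj?   = λ x y → adj? x y ×-dec (x ≟ v →-dec y ∈? S) ×-dec (y ≟ v →-dec x ∈? S)
    ; sym    = λ (xy , p , q) → sym xy , q , p
    ; irrefl = λ x≡y (xy , _) → irrefl x≡y xy
    }

  private module H = Graph restrictAt

  restrictAt-chordal : (∀ {y z} → Adj v y → Adj v z → y ≢ z → Adj y z) → Chordal → H.Chordal
  restrictAt-chordal simp chordal C 3<size with any? (v ≟_) (H.Cycle.vertices C)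
  ... | yes v∈ with ∈-∃++ v∈
  ...   | xs , ys , eq = chord-through restrictAt simp′ C xs eq 3<size
    where
    -- Neighbours of `v` differ from `v`, so the edge joining two of them survives the deletion.
    simp′ : ∀ {a b} → H.Adj v a → H.Adj v b → a ≢ b → H.Adj a b
    simp′ (va , _) (vb , _) a≢b = simp va vb a≢b ,
      (λ { refl → contradiction va (irrefl refl) }) , (λ { refl → contradiction vb (irrefl refl) })
  restrictAt-chordal simp chordal C 3<size | no v∉
    with chordal record
           { start = H.Cycle.start C ; rest = H.Cycle.rest C ; distinct = H.Cycle.distinct C
           ; linked = Linked.map proj₁ (H.Cycle.linked C) ; length≥3 = H.Cycle.length≥3 C } 3<size
  ... | u , w , uw , ¬edge , u∈ , w∈ =
    -- The ends of the chord lie on a cycle avoiding `v`, so the chord was not deleted.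
    u , w , (uw , (λ { refl → contradiction u∈ v∉ }) , (λ { refl → contradiction w∈ v∉ })) ,
    ¬edge , u∈ , w∈

  degree-restrictAt : S ⊆ neighbours v → H.degree v ≡ ∣ S ∣
  degree-restrictAt S⊆ = ≤-antisym
    (p⊆q⇒∣p∣≤∣q∣ (λ w∈ → proj₁ (proj₂ (∈-neighbours⁻ restrictAt w∈)) refl))
    (p⊆q⇒∣p∣≤∣q∣ (λ w∈ → ∈-neighbours⁺ restrictAt
      (∈-neighbours⁻ G (S⊆ w∈) , (λ _ → w∈) ,
       (λ { refl → contradiction (∈-neighbours⁻ G (S⊆ w∈)) (irrefl refl) }))))

  -- The only neighbour that `x` can lose is `v`.
  degree-restrictAt-≢ : ∀ {x} → x ≢ v → degree x ≤ suc (H.degree x)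
  degree-restrictAt-≢ x≢v = p-x⊆q⇒∣p∣≤1+∣q∣ v λ y≢v y∈ → ∈-neighbours⁺ restrictAt
    (∈-neighbours⁻ G y∈ , (λ x≡v → contradiction x≡v x≢v) , (λ y≡v → contradiction y≡v y≢v))

lemma3 : ∀ {n} (G : Graph n) (k p : ℕ) →
    Graph.Chordal G → Graph.MinDegree G k → p < k →
    ∃[ H ] SpanningSubgraph H G × Graph.Chordal H × Graph.MinDegree H p
-- The vertex `v₀` of degree `k` shows that the graph is nonempty, so a simplicial vertex exists.
lemma3 G k p chordal (k≤degree , v₀ , _) p<k with simplicial-vertex G chordal v₀
... | v , simp with subset-of-size p (Graph.neighbours G v) (≤-trans (<⇒≤ p<k) (k≤degree v))
...   | S , S⊆ , ∣S∣≡p =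
  restrictAt G v S , proj₁ , restrictAt-chordal G v S simp chordal , p≤degree , v , degree-v
  where
  degree-v = trans (degree-restrictAt G v S S⊆) ∣S∣≡p

  -- Not a with-abstraction: x ≟ v also occurs in the degree in restrictAt.
  p≤degree′ : ∀ {x} → Dec (x ≡ v) → p ≤ Graph.degree (restrictAt G v S) x
  p≤degree′ (yes refl) = ≤-reflexive (≡-sym degree-v)
  p≤degree′ (no x≢v)   = s≤s⁻¹ (≤-trans p<k (≤-trans (k≤degree _) (degree-restrictAt-≢ G v S x≢v)))

  p≤degree : ∀ x → p ≤ Graph.degree (restrictAt G v S) x
  p≤degree x = p≤degree′ (x ≟ v)
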